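{- For $j=1$ or $j=2$ and every integer $n\ge 0$, $$\sum_{k=0}^{n}(-1)^{k}\det\begin{pmatrix} M_{n,k}(2,2) & M_{n,k+1}(2,2)\\ M_{n+j,k}(2,2) & M_{n+j,k+1}(2,2)\end{pmatrix}=4^{j-1}C_{n+1};$$ or equivalently, for $j=1$, $$C_{n+1}=\sum_{k=0}^{n}(-1)^k\frac{(2k+2)(2k+3)(2k+4)}{(2n+2)(2n+3)(2n+4)^2}\binom{2n+4}{n-k}\binom{2n+4}{n-k+1},$$ and for $j=2$, $$2C_{n+1}=\sum_{k=0}^{n}(-1)^k\frac{(2k+2)(2k+3)(2k+4)}{(2n+2)(2n+3)(2n+6)(2n+7)}\binom{2n+3}{n-k}\binom{2n+7}{n-k+2}.$$
   Context: $C_n=\frac{1}{n+1}\binom{2n}{n}$ is the $n$-th Catalan number. A partial Motzkin path from $(0,0)$ to $(n,k)$ is a lattice path that never goes below the $X$-axis and consists of up steps $U=(1,1)$, down steps $D=(1,-1)$ and horizontal steps $H=(1,0)$. Every up step and every down step has weight $1$, every horizontal step lying on the $X$-axis has weight $x$, and every horizontal step not lying on the $X$-axis has weight $y$; the weight of a path is the product of the weights of its steps. $M_{n,k}(x,y)$ is the sum of the weights of all partial Motzkin paths from $(0,0)$ to $(n,k)$. Equivalently, $M_{0,0}(x,y)=1$, $M_{n,k}(x,y)=0$ if $n<k$ or $k<0$, $M_{n,0}(x,y)=xM_{n-1,0}(x,y)+M_{n-1,1}(x,y)$ for $n\ge1$, and $M_{n,k}(x,y)=M_{n-1,k-1}(x,y)+yM_{n-1,k}(x,y)+M_{n-1,k+1}(x,y)$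 for $n\ge k\ge 1$. $M_{n,k}(2,2)$ is the value at $x=y=2$; explicitly $M_{n,k}(2,2)=\frac{2k+2}{2n+2}\binom{2n+2}{n-k}$ for $n\ge k\ge 0$. -}

module Defs where

open import Data.Fin using (toℕ)
open import Data.Integer as ℤ using (ℤ; 1ℤ; 0ℤ)
import Data.Integer.Properties as ℤ
open import Data.List using (List; []; _∷_; _++_; map; foldr)
open import Data.List.Membership.Propositional using (_∈_)
open import Data.List.Membership.Propositional.Properties
  using (∈-map⁺; ∈-map⁻; ∈-++⁺ˡ; ∈-++⁺ʳ; ∈-++⁻)
open import Data.List.Relation.Binary.Disjoint.Propositional using (Disjoint)
open import Data.List.Relation.Unary.All using ([])
open import Data.List.Relation.Unary.Any using (here)
open import Data.List.Relation.Unary.Unique.Propositional using (Unique; []; _∷_)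
open import Data.List.Relation.Unary.Unique.Propositional.Properties using (map⁺; ++⁺)
open import Data.Nat using (ℕ; zero; suc; _+_; _*_; _/_)
open import Data.Nat.Combinatorics using (_C_; nC1≡n; nCk+nC[k+1]≡[n+1]C[k+1])
open import Data.Nat.Divisibility using (_∣_; divides; ∣m+n∣m⇒∣n; m∣m*n)
open import Data.Nat.DivMod using (m*[n/m]≡n)
open import Data.Nat.Properties using (*-comm)
open import Data.Nat.Tactic.RingSolver using (solve-∀)
open import Data.Product using (_,_)
open import Data.Rational as ℚ using (ℚ)
import Data.Rational.Properties as ℚ
open import Data.Sum using (inj₁; inj₂)
open import Relation.Binary.PropositionalEquality
  using (_≡_; refl; sym; trans; cong; cong₂; subst; module ≡-Reasoning)

import Algebra.Properties.Monoid.Sum as MonoidSum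
private
  module Sumℤ = MonoidSum ℤ.+-0-monoid
  module Sumℚ = MonoidSum ℚ.+-0-monoid

-- Both sums range over k = 0, 1, …, n, with n included.
∑ℤ-syntax : ℕ → (ℕ → ℤ) → ℤ
∑ℤ-syntax n f = Sumℤ.sum {suc n} (λ k → f (toℕ k))

∑ℚ-syntax : ℕ → (ℕ → ℚ) → ℚ
∑ℚ-syntax n f = Sumℚ.sum {suc n} (λ k → f (toℕ k))

infixl 5 ∑ℤ-syntax ∑ℚ-syntax
syntax ∑ℤ-syntax n (λ k → t) = ∑ℤ[ k ≤ n ] t
syntax ∑ℚ-syntax n (λ k → t) = ∑ℚ[ k ≤ n ] t

fromℤ : ℤ → ℚ
fromℤ z = z ℚ./ 1

fromℕ : ℕ → ℚ
fromℕ m = fromℤ (ℤ.+ m)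

-- Determinant of the matrix with rows (a , b) and (c , d).
det₂ : (a b c d : ℤ) → ℤ
det₂ a b c d = a ℤ.* d ℤ.- b ℤ.* c

-- Path n k: partial Motzkin paths from (0,0) to (n,k).  Steps are appended on
-- the right; heights are natural numbers, so no path goes below the X-axis.
data Path : ℕ → ℕ → Set where
  ε  : Path 0 0
  _U : ∀ {n k} → Path n k       → Path (suc n) (suc k)
  _D : ∀ {n k} → Path n (suc k) → Path (suc n) k
  _H : ∀ {n k} → Path n k       → Path (suc n) k

-- Weight of a horizontal step at the given height.
weightH : (x y : ℤ) → ℕ → ℤ
weightH x y zero    = x
weightH x y (suc _) = y

weight : (x y : ℤ) → ∀ {n k} → Path n k → ℤ
weight x y ε              = 1ℤ
weight x y (p U)          = weight x y p ℤ.* 1ℤ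
weight x y (p D)          = weight x y p ℤ.* 1ℤ
weight x y (_H {k = k} p) = weight x y p ℤ.* weightH x y k

-- All elements of Path n k, each listed exactly once: see paths-complete and
-- paths-unique.
paths : ∀ n k → List (Path n k)
paths zero    zero    = ε ∷ []
paths zero    (suc k) = []
paths (suc n) zero    = map _H (paths n 0) ++ map _D (paths n 1)
paths (suc n) (suc k) =
  map _U (paths n k) ++ map _H (paths n (suc k)) ++ map _D (paths n (suc (suc k)))

M : (n k : ℕ) (x y : ℤ) → ℤ
M n k x y = foldr ℤ._+_ 0ℤ (map (weight x y) (paths n k))

paths-complete : ∀ {n k} (p : Path n k) → p ∈ paths n k
paths-complete ε                = here refl
paths-complete (p U)            = ∈-++⁺ˡ (∈-map⁺ _U (paths-complete p))
paths-complete (_D {k = zero} p)  =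
  ∈-++⁺ʳ (map _H (paths _ 0)) (∈-map⁺ _D (paths-complete p))
paths-complete (_D {k = suc k} p) =
  ∈-++⁺ʳ (map _U (paths _ k))
    (∈-++⁺ʳ (map _H (paths _ (suc k))) (∈-map⁺ _D (paths-complete p)))
paths-complete (_H {k = zero} p)  = ∈-++⁺ˡ (∈-map⁺ _H (paths-complete p))
paths-complete (_H {k = suc k} p) =
  ∈-++⁺ʳ (map _U (paths _ k)) (∈-++⁺ˡ (∈-map⁺ _H (paths-complete p)))

private
  U-injective : ∀ {n k} {p q : Path n k} → p U ≡ q U → p ≡ q
  U-injective refl = refl

  D-injective : ∀ {n k} {p q : Path n (suc k)} → p D ≡ q D → p ≡ q
  D-injective refl = refl

  H-injective : ∀ {n k} {p q : Path n k} → p H ≡ q H → p ≡ q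
  H-injective refl = refl

  H#D : ∀ {n k} (ps : List (Path n k)) (qs : List (Path n (suc k))) →
        Disjoint (map _H ps) (map _D qs)
  H#D ps qs (i , j) with ∈-map⁻ _H i | ∈-map⁻ _D j
  ... | _ , _ , refl | _ , _ , ()

  U#H++D : ∀ {n k} (ps : List (Path n k)) (qs : List (Path n (suc k)))
           (rs : List (Path n (suc (suc k)))) →
           Disjoint (map _U ps) (map _H qs ++ map _D rs)
  U#H++D ps qs rs (i , j) with ∈-map⁻ _U i | ∈-++⁻ (map _H qs) j
  ... | _ , _ , refl | inj₁ h with ∈-map⁻ _H h
  ...   | _ , _ , ()
  U#H++D ps qs rs (i , j) | _ , _ , refl | inj₂ d with ∈-map⁻ _D d
  ...   | _ , _ , ()

paths-unique : ∀ n k → Unique (paths n k)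
paths-unique zero    zero    = [] ∷ []
paths-unique zero    (suc k) = []
paths-unique (suc n) zero    =
  ++⁺ (map⁺ H-injective (paths-unique n 0))
      (map⁺ D-injective (paths-unique n 1))
      (H#D (paths n 0) (paths n 1))
paths-unique (suc n) (suc k) =
  ++⁺ (map⁺ U-injective (paths-unique n k))
      (++⁺ (map⁺ H-injective (paths-unique n (suc k)))
           (map⁺ D-injective (paths-unique n (suc (suc k))))
           (H#D (paths n (suc k)) (paths n (suc (suc k)))))
      (U#H++D (paths n k) (paths n (suc k)) (paths n (suc (suc k))))

-- The division is exact: see Catalan-exact.
Catalan : ℕ → ℕ
Catalan n = ((2 * n) C n) / suc n

absorption : ∀ n k → suc k * (suc n C suc k) ≡ suc n * (n C k)
absorption zero    zero    = refl
absorption zero    (suc k) = *-comm (suc (suc k)) 0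
absorption (suc n) zero    =
  trans (cong (1 *_) (nC1≡n (suc (suc n)))) (*-comm 1 (suc (suc n)))
absorption (suc n) (suc k) = begin
  suc (suc k) * (suc (suc n) C suc (suc k))
    ≡⟨ cong (suc (suc k) *_) (nCk+nC[k+1]≡[n+1]C[k+1] (suc n) (suc k)) ⟨
  suc (suc k) * (c + d)
    ≡⟨ expand k c d ⟩
  c + (suc k * c + suc (suc k) * d)
    ≡⟨ cong (c +_) (cong₂ _+_ (absorption n k) (absorption n (suc k))) ⟩
  c + (suc n * a + suc n * b)
    ≡⟨ factor c n a b ⟩
  c + suc n * (a + b)
    ≡⟨ cong (λ t → c + suc n * t) (nCk+nC[k+1]≡[n+1]C[k+1] n k) ⟩
  c + suc n * c ∎
  where
  open ≡-Reasoning
  a b c d : ℕ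
  a = n C k
  b = n C suc k
  c = suc n C suc k
  d = suc n C suc (suc k)
  expand : ∀ k c d → suc (suc k) * (c + d) ≡ c + (suc k * c + suc (suc k) * d)
  expand = solve-∀
  factor : ∀ c n a b → c + (suc n * a + suc n * b) ≡ c + suc n * (a + b)
  factor = solve-∀

Catalan-exact : ∀ n → suc n * Catalan n ≡ (2 * n) C n
Catalan-exact n = m*[n/m]≡n (∣m+n∣m⇒∣n sum∣ odd∣)
  where
  B : ℕ
  B = (2 * n) C n
  odd∣ : suc n ∣ suc (2 * n) * B
  odd∣ = subst (suc n ∣_) (absorption (2 * n) n) (m∣m*n _)
  rearrange : ∀ n b → suc (2 * n) * b + b ≡ 2 * b * suc n
  rearrange = solve-∀
  sum∣ : suc n ∣ suc (2 * n) * B + B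
  sum∣ = divides (2 * B) (rearrange n B)

{-# OPTIONS --safe #-}
module Submission where

-- At x = y = 2 the rows satisfy row (n + 1) = T (row n) with T = 2 + N, where
-- N adds the two neighbouring entries; put e = row 0.  For the alternating sum
-- ω of the 2 × 2 minors of two rows N is skew, so T has the adjoint T* = 2 − N,
-- and ω (Tⁿ e) (Tⁿ b) = ω e ((T* T)ⁿ b) is the entry of (T* T)ⁿ b at height 1.
-- As T* T = 4 − N² preserves the parity of heights and acts on the odd ones,
-- with alternating signs inserted, as T itself, that entry is a multiple of
-- M n 0, a Catalan number; the multiple is 1 for b = row 1 and 4 for b = row 2.
-- The binomial sums have the same terms, halved for j = 2.

open import Defs
open import Data.Fin using (toℕ)
import Data.Fin.Properties as Fin
open import Data.Integer as ℤ using (ℤ; +_; -1ℤ; 0ℤ; 1ℤ)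
import Data.Integer.Properties as ℤ
import Data.Integer.Tactic.RingSolver as ℤ
open import Data.List using (List; []; _∷_; _++_; map; foldr)
open import Data.Nat using (ℕ; zero; suc; _+_; _*_; _∸_; _^_; _≤_; _<_; s≤s; z≤n; _!; NonZero)
open import Data.Nat.Combinatorics using (_C_; nCk≡n!/k![n-k]!; k![n∸k]!∣n!)
open import Data.Nat.DivMod using (m*[n/m]≡n)
open import Data.Nat.GeneralisedArithmetic using (fold)
open import Data.Nat.Properties
open import Data.Nat.Tactic.RingSolver using (solve-∀)
open import Data.Product using (_×_; _,_)
open import Data.Rational as ℚ using (ℚ)
import Data.Rational.Properties as ℚ
open import Data.Rational.Unnormalised as ℚᵘ using (ℚᵘ; mkℚᵘ; *≡*)
import Data.Rational.Unnormalised.Properties as ℚᵘ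
open import Data.Sum using (_⊎_; inj₁; inj₂)
open import Relation.Binary.PropositionalEquality

open import Algebra.Bundles using (CommutativeRing)
import Algebra.Properties.Monoid.Sum as MonoidSum
import Algebra.Properties.Semiring.Sum as SemiringSum
private
  module Sumℤ = MonoidSum ℤ.+-0-monoid
  module Sumℚ = SemiringSum (CommutativeRing.semiring ℚ.+-*-commutativeRing)

-- Rows of the Motzkin triangle

totalWeight : (x y : ℤ) → ∀ {n k} → List (Path n k) → ℤ
totalWeight x y ps = foldr ℤ._+_ 0ℤ (map (weight x y) ps)

totalWeight-++ : ∀ x y {n k} (ps qs : List (Path n k)) →
  totalWeight x y (ps ++ qs) ≡ totalWeight x y ps ℤ.+ totalWeight x y qs
totalWeight-++ x y []       qs = sym (ℤ.+-identityˡ _)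
totalWeight-++ x y (p ∷ ps) qs = trans
  (cong (λ t → weight x y p ℤ.+ t) (totalWeight-++ x y ps qs))
  (sym (ℤ.+-assoc (weight x y p) _ _))

-- The constant `c` is the weight of the appended step. It can be factored out of the whole sum
-- because that weight depends only on the height at which the step is taken, which all paths of the
-- list share.
totalWeight-map : ∀ x y {n k n′ k′} (f : Path n k → Path n′ k′) c →
  (∀ p → weight x y (f p) ≡ weight x y p ℤ.* c) →
  ∀ ps → totalWeight x y (map f ps) ≡ totalWeight x y ps ℤ.* c
totalWeight-map x y f c eq []       = sym (ℤ.*-zeroˡ c)
totalWeight-map x y f c eq (p ∷ ps) = trans
  (cong₂ ℤ._+_ (eq p) (totalWeight-map x y f c eq ps))
  (sym (ℤ.*-distribʳ-+ c (weight x y p) _))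

-- Values in ℕ allow the closed form below to be proved by multiplying with factorials and
-- cancelling them, with no signs involved.
motzkin : ℕ → ℕ → ℕ
motzkin zero    zero    = 1
motzkin zero    (suc k) = 0
motzkin (suc n) zero    = 2 * motzkin n 0 + motzkin n 1
motzkin (suc n) (suc k) = motzkin n k + 2 * motzkin n (suc k) + motzkin n (suc (suc k))

M≡motzkin : ∀ n k → M n k (+ 2) (+ 2) ≡ + motzkin n k
M≡motzkin zero    zero    = refl
M≡motzkin zero    (suc k) = refl
M≡motzkin (suc n) zero    = begin
  W (map _H (paths n 0) ++ map _D (paths n 1))
    ≡⟨ totalWeight-++ _ _ (map _H (paths n 0)) _ ⟩
  W (map _H (paths n 0)) ℤ.+ W (map _D (paths n 1))
    ≡⟨ cong₂ ℤ._+_ (totalWeight-map _ _ _H (+ 2) (λ _ → refl) (paths n 0))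
                   (totalWeight-map _ _ _D 1ℤ (λ _ → refl) (paths n 1)) ⟩
  M n 0 (+ 2) (+ 2) ℤ.* + 2 ℤ.+ M n 1 (+ 2) (+ 2) ℤ.* 1ℤ
    ≡⟨ cong₂ (λ a b → a ℤ.* + 2 ℤ.+ b ℤ.* 1ℤ) (M≡motzkin n 0) (M≡motzkin n 1) ⟩
  + motzkin n 0 ℤ.* + 2 ℤ.+ + motzkin n 1 ℤ.* 1ℤ
    ≡⟨ cong₂ ℤ._+_ (ℤ.*-comm (+ motzkin n 0) (+ 2)) (ℤ.*-identityʳ (+ motzkin n 1)) ⟩
  + 2 ℤ.* + motzkin n 0 ℤ.+ + motzkin n 1
    ≡⟨ cong (ℤ._+ + motzkin n 1) (ℤ.pos-* 2 (motzkin n 0)) ⟨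
  + motzkin (suc n) 0 ∎
  where
  open ≡-Reasoning
  W : ∀ {n k} → List (Path n k) → ℤ
  W = totalWeight (+ 2) (+ 2)
M≡motzkin (suc n) (suc k) = begin
  W (map _U (paths n k) ++ map _H (paths n (suc k)) ++ map _D (paths n (suc (suc k))))
    ≡⟨ trans (totalWeight-++ _ _ (map _U (paths n k)) _)
             (cong (λ t → W (map _U (paths n k)) ℤ.+ t)
                   (totalWeight-++ _ _ (map _H (paths n (suc k))) _)) ⟩
  W (map _U (paths n k)) ℤ.+ (W (map _H (paths n (suc k))) ℤ.+ W (map _D (paths n (suc (suc k)))))
    ≡⟨ cong₂ ℤ._+_ (totalWeight-map _ _ _U 1ℤ (λ _ → refl) (paths n k))
         (cong₂ ℤ._+_ (totalWeight-map _ _ _H (+ 2) (λ _ → refl) (paths n (suc k)))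
                      (totalWeight-map _ _ _D 1ℤ (λ _ → refl) (paths n (suc (suc k))))) ⟩
  M n k (+ 2) (+ 2) ℤ.* 1ℤ ℤ.+
    (M n (suc k) (+ 2) (+ 2) ℤ.* + 2 ℤ.+ M n (suc (suc k)) (+ 2) (+ 2) ℤ.* 1ℤ)
    ≡⟨ cong₂ (λ a t → a ℤ.* 1ℤ ℤ.+ t) (M≡motzkin n k)
         (cong₂ (λ b c → b ℤ.* + 2 ℤ.+ c ℤ.* 1ℤ) (M≡motzkin n (suc k)) (M≡motzkin n (suc (suc k)))) ⟩
  + motzkin n k ℤ.* 1ℤ ℤ.+
    (+ motzkin n (suc k) ℤ.* + 2 ℤ.+ + motzkin n (suc (suc k)) ℤ.* 1ℤ)
    ≡⟨ rearrange (+ motzkin n k) (+ motzkin n (suc k)) (+ motzkin n (suc (suc k))) ⟩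
  + motzkin n k ℤ.+ + 2 ℤ.* + motzkin n (suc k) ℤ.+ + motzkin n (suc (suc k))
    ≡⟨ cong (λ t → + motzkin n k ℤ.+ t ℤ.+ + motzkin n (suc (suc k)))
            (ℤ.pos-* 2 (motzkin n (suc k))) ⟨
  + motzkin (suc n) (suc k) ∎
  where
  open ≡-Reasoning
  W : ∀ {n k} → List (Path n k) → ℤ
  W = totalWeight (+ 2) (+ 2)
  rearrange : ∀ a b c → a ℤ.* 1ℤ ℤ.+ (b ℤ.* + 2 ℤ.+ c ℤ.* 1ℤ) ≡ a ℤ.+ + 2 ℤ.* b ℤ.+ c
  rearrange = ℤ.solve-∀

motzkin-vanishes : ∀ {n k} → n < k → motzkin n k ≡ 0
motzkin-vanishes {zero}  {suc k} _         = refl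
motzkin-vanishes {suc n} {suc k} (s≤s n<k)
  rewrite motzkin-vanishes n<k
        | motzkin-vanishes {n} {suc k} (m≤n⇒m≤1+n n<k)
        | motzkin-vanishes {n} {suc (suc k)} (m≤n⇒m≤1+n (m≤n⇒m≤1+n n<k)) = refl

-- The transfer operator and its adjoint

row : ℕ → ℕ → ℤ
row n k = + motzkin n k

T : (ℕ → ℤ) → ℕ → ℤ
T a zero    = + 2 ℤ.* a 0 ℤ.+ a 1
T a (suc k) = a k ℤ.+ + 2 ℤ.* a (suc k) ℤ.+ a (suc (suc k))

-- Adjoint of T with respect to ω: see ω-T.
T* : (ℕ → ℤ) → ℕ → ℤ
T* a zero    = + 2 ℤ.* a 0 ℤ.- a 1
T* a (suc k) = + 2 ℤ.* a (suc k) ℤ.- a k ℤ.- a (suc (suc k))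

T-cong : ∀ {a b} → a ≗ b → T a ≗ T b
T-cong a≗b zero    = cong₂ (λ s t → + 2 ℤ.* s ℤ.+ t) (a≗b 0) (a≗b 1)
T-cong a≗b (suc k) = cong₂ ℤ._+_
  (cong₂ (λ s t → s ℤ.+ + 2 ℤ.* t) (a≗b k) (a≗b (suc k))) (a≗b (suc (suc k)))

row-suc : ∀ n → row (suc n) ≗ T (row n)
row-suc n zero    = cong (ℤ._+ row n 1) (ℤ.pos-* 2 (motzkin n 0))
row-suc n (suc k) =
  cong (λ t → row n k ℤ.+ t ℤ.+ row n (suc (suc k))) (ℤ.pos-* 2 (motzkin n (suc k)))

row-+ : ∀ m n → row (m + n) ≗ fold (row n) T m
row-+ zero    n k = refl
row-+ (suc m) n k = trans (row-suc (m + n) k) (T-cong (row-+ m n) k)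

-- Both operators are polynomials in the neighbour sum N, namely 2 + N and 2 - N. The composites
-- reach two heights down, so heights 0 and 1 meet the boundary and are checked separately.
T*T≗TT* : ∀ a → T* (T a) ≗ T (T* a)
T*T≗TT* a zero = identity (a 0) (a 1) (a 2)
  where
  identity : ∀ x y z → + 2 ℤ.* (+ 2 ℤ.* x ℤ.+ y) ℤ.- (x ℤ.+ + 2 ℤ.* y ℤ.+ z)
    ≡ + 2 ℤ.* (+ 2 ℤ.* x ℤ.- y) ℤ.+ (+ 2 ℤ.* y ℤ.- x ℤ.- z)
  identity = ℤ.solve-∀
T*T≗TT* a (suc zero) = identity (a 0) (a 1) (a 2) (a 3)
  where
  identity : ∀ x y z w →
    + 2 ℤ.* (x ℤ.+ + 2 ℤ.* y ℤ.+ z) ℤ.- (+ 2 ℤ.* x ℤ.+ y) ℤ.- (y ℤ.+ + 2 ℤ.* z ℤ.+ w)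
    ≡ (+ 2 ℤ.* x ℤ.- y) ℤ.+ + 2 ℤ.* (+ 2 ℤ.* y ℤ.- x ℤ.- z) ℤ.+ (+ 2 ℤ.* z ℤ.- y ℤ.- w)
  identity = ℤ.solve-∀
T*T≗TT* a (suc (suc k)) = identity (a k) (a (1 + k)) (a (2 + k)) (a (3 + k)) (a (4 + k))
  where
  identity : ∀ v x y z w →
    + 2 ℤ.* (x ℤ.+ + 2 ℤ.* y ℤ.+ z) ℤ.- (v ℤ.+ + 2 ℤ.* x ℤ.+ y) ℤ.- (y ℤ.+ + 2 ℤ.* z ℤ.+ w)
    ≡ (+ 2 ℤ.* x ℤ.- v ℤ.- y) ℤ.+ + 2 ℤ.* (+ 2 ℤ.* y ℤ.- x ℤ.- z) ℤ.+ (+ 2 ℤ.* z ℤ.- y ℤ.- w)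
  identity = ℤ.solve-∀

-- Commutation carries the pair `T*`, `T` past the remaining copies of `T` down to the base row `b`,
-- where its effect on odd heights can be followed.
T*T-fold : ∀ b m → T* (T (fold b T m)) ≗ fold (T* (T b)) T m
T*T-fold b zero    k = refl
T*T-fold b (suc m) k = trans (T*T≗TT* (T (fold b T m)) k) (T-cong (T*T-fold b m) k)

-- `∑ℤ-syntax` unfolds at its first term, whereas induction on the upper limit of `ω` has to split
-- off the last one.
∑-snoc : ∀ n (f : ℕ → ℤ) → ∑ℤ-syntax (suc n) f ≡ ∑ℤ-syntax n f ℤ.+ f (suc n)
∑-snoc zero    f = identity (f 0) (f 1)
  where
  identity : ∀ x y → x ℤ.+ (y ℤ.+ 0ℤ) ≡ x ℤ.+ 0ℤ ℤ.+ y
  identity = ℤ.solve-∀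
∑-snoc (suc n) f = trans
  (cong (λ t → f 0 ℤ.+ t) (∑-snoc n (λ k → f (suc k))))
  (sym (ℤ.+-assoc (f 0) _ _))

∑-cong : ∀ n {f g : ℕ → ℤ} → f ≗ g → ∑ℤ-syntax n f ≡ ∑ℤ-syntax n g
∑-cong n f≗g = Sumℤ.sum-cong-≗ {suc n} (λ k → f≗g (toℕ k))

-- The alternating sum of minors

signedMinor : (a b : ℕ → ℤ) → ℕ → ℤ
signedMinor a b k = (-1ℤ ℤ.^ k) ℤ.* det₂ (a k) (a (suc k)) (b k) (b (suc k))

ω : ℕ → (a b : ℕ → ℤ) → ℤ
ω K a b = ∑ℤ[ k ≤ K ] signedMinor a b k

ω-suc : ∀ K a b → ω (suc K) a b ≡ ω K a b ℤ.+ signedMinor a b (suc K)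
ω-suc K a b = ∑-snoc K (signedMinor a b)

ω-cong : ∀ K {a a′ b b′} → a ≗ a′ → b ≗ b′ → ω K a b ≡ ω K a′ b′
ω-cong K {a} {a′} {b} {b′} a≗a′ b≗b′ = ∑-cong K (λ k → cong (λ d → (-1ℤ ℤ.^ k) ℤ.* d)
  (cong₂ ℤ._-_ (cong₂ ℤ._*_ (a≗a′ k) (b≗b′ (suc k))) (cong₂ ℤ._*_ (a≗a′ (suc k)) (b≗b′ k))))

-- The summand 2 of `T` moves across by bilinearity. For N, put g k = a k b (k + 2) - a (k + 2) b k
-- and g (-1) = 0: moving N from `a` to `b` with a change of sign leaves the sum of (-1)^k (g k + g
-- (k - 1)), which telescopes to the boundary term at `K`.
ω-T : ∀ K a b → ω K (T a) b ≡
  ω K a (T* b) ℤ.+ (-1ℤ ℤ.^ K) ℤ.* (a K ℤ.* b (2 + K) ℤ.- a (2 + K) ℤ.* b K)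
ω-T zero a b = identity (a 0) (a 1) (a 2) (b 0) (b 1) (b 2)
  where
  identity : ∀ a₀ a₁ a₂ b₀ b₁ b₂ →
    1ℤ ℤ.* ((+ 2 ℤ.* a₀ ℤ.+ a₁) ℤ.* b₁ ℤ.- (a₀ ℤ.+ + 2 ℤ.* a₁ ℤ.+ a₂) ℤ.* b₀) ℤ.+ 0ℤ ≡
    1ℤ ℤ.* (a₀ ℤ.* (+ 2 ℤ.* b₁ ℤ.- b₀ ℤ.- b₂) ℤ.- a₁ ℤ.* (+ 2 ℤ.* b₀ ℤ.- b₁)) ℤ.+ 0ℤ
      ℤ.+ 1ℤ ℤ.* (a₀ ℤ.* b₂ ℤ.- a₂ ℤ.* b₀)
  identity = ℤ.solve-∀
ω-T (suc K) a b = begin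
  ω (suc K) (T a) b
    ≡⟨ ω-suc K (T a) b ⟩
  ω K (T a) b ℤ.+ signedMinor (T a) b (suc K)
    ≡⟨ cong (λ t → t ℤ.+ signedMinor (T a) b (suc K)) (ω-T K a b) ⟩
  ω K a (T* b) ℤ.+ (-1ℤ ℤ.^ K) ℤ.* (a K ℤ.* b (2 + K) ℤ.- a (2 + K) ℤ.* b K)
    ℤ.+ signedMinor (T a) b (suc K)
    ≡⟨ identity (ω K a (T* b)) (-1ℤ ℤ.^ K) (a K) (a (1 + K)) (a (2 + K)) (a (3 + K))
                (b K) (b (1 + K)) (b (2 + K)) (b (3 + K)) ⟩
  ω K a (T* b) ℤ.+ signedMinor a (T* b) (suc K) ℤ.+ boundary
    ≡⟨ cong (λ t → t ℤ.+ boundary) (ω-suc K a (T* b)) ⟨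
  ω (suc K) a (T* b) ℤ.+ boundary ∎
  where
  open ≡-Reasoning
  boundary : ℤ
  boundary = (-1ℤ ℤ.^ suc K) ℤ.* (a (1 + K) ℤ.* b (3 + K) ℤ.- a (3 + K) ℤ.* b (1 + K))
  identity : ∀ w s a₀ a₁ a₂ a₃ b₀ b₁ b₂ b₃ →
    w ℤ.+ s ℤ.* (a₀ ℤ.* b₂ ℤ.- a₂ ℤ.* b₀)
      ℤ.+ (-1ℤ ℤ.* s) ℤ.* ((a₀ ℤ.+ + 2 ℤ.* a₁ ℤ.+ a₂) ℤ.* b₂ ℤ.- (a₁ ℤ.+ + 2 ℤ.* a₂ ℤ.+ a₃) ℤ.* b₁) ≡
    (w ℤ.+ (-1ℤ ℤ.* s) ℤ.* (a₁ ℤ.* (+ 2 ℤ.* b₂ ℤ.- b₁ ℤ.- b₃) ℤ.- a₂ ℤ.* (+ 2 ℤ.* b₁ ℤ.- b₀ ℤ.- b₂)))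
      ℤ.+ (-1ℤ ℤ.* s) ℤ.* (a₁ ℤ.* b₃ ℤ.- a₃ ℤ.* b₁)
  identity = ℤ.solve-∀

-- Row 0 is (1, 0, 0, ...), so only the minor at height 0 survives.
ω-row0 : ∀ K b → ω K (row 0) b ≡ b 1
ω-row0 zero    b = identity (b 0) (b 1)
  where
  identity : ∀ x y → 1ℤ ℤ.* (1ℤ ℤ.* y ℤ.- 0ℤ ℤ.* x) ℤ.+ 0ℤ ≡ y
  identity = ℤ.solve-∀
ω-row0 (suc K) b = trans (ω-suc K (row 0) b) (trans
  (cong₂ ℤ._+_ (ω-row0 K b) (identity (-1ℤ ℤ.^ suc K) (b (suc K)) (b (suc (suc K)))))
  (ℤ.+-identityʳ (b 1)))
  where
  identity : ∀ s x y → s ℤ.* (0ℤ ℤ.* y ℤ.- 0ℤ ℤ.* x) ≡ 0ℤ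
  identity = ℤ.solve-∀

-- The boundary term of `ω-T` contains row `m` only at heights `K` and `K + 2`, both above the top
-- of that row.
ω-row-suc : ∀ {K m} b → m < K → ω K (row (suc m)) b ≡ ω K (row m) (T* b)
ω-row-suc {K} {m} b m<K = begin
  ω K (row (suc m)) b   ≡⟨ ω-cong K {b = b} (row-suc m) (λ _ → refl) ⟩
  ω K (T (row m)) b     ≡⟨ ω-T K (row m) b ⟩
  ω K (row m) (T* b) ℤ.+ (-1ℤ ℤ.^ K) ℤ.* (row m K ℤ.* b (2 + K) ℤ.- row m (2 + K) ℤ.* b K)
    ≡⟨ cong₂ (λ u v → ω K (row m) (T* b) ℤ.+ (-1ℤ ℤ.^ K) ℤ.* (+ u ℤ.* b (2 + K) ℤ.- + v ℤ.* b K))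
             (motzkin-vanishes m<K) (motzkin-vanishes (m≤n⇒m≤o+n 2 m<K)) ⟩
  ω K (row m) (T* b) ℤ.+ (-1ℤ ℤ.^ K) ℤ.* (0ℤ ℤ.* b (2 + K) ℤ.- 0ℤ ℤ.* b K)
    ≡⟨ identity (ω K (row m) (T* b)) (-1ℤ ℤ.^ K) (b (2 + K)) (b K) ⟩
  ω K (row m) (T* b) ∎
  where
  open ≡-Reasoning
  identity : ∀ w s x y → w ℤ.+ s ℤ.* (0ℤ ℤ.* x ℤ.- 0ℤ ℤ.* y) ≡ w
  identity = ℤ.solve-∀

-- Odd heights under the composite of T* and T

odd : ℕ → ℕ
odd zero    = 1
odd (suc l) = 2 + odd l

-- The entries of `b` at heights 1, 3, 5, ... form `s` times `c` with alternating signs; even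
-- heights are unconstrained. The recursion of `odd` makes the next odd height definitionally two
-- higher, so `T*` and `T` unfold there.
OddPart : (b : ℕ → ℤ) (s : ℤ) (c : ℕ → ℤ) → Set
OddPart b s c = ∀ l → b (odd l) ≡ s ℤ.* ((-1ℤ ℤ.^ l) ℤ.* c l)

-- In 4 - N² the even heights cancel: what remains at an odd height is twice the entry minus its two
-- neighbours at distance two. The alternating signs turn these minuses into pluses, which gives
-- `T c`. At height 1 the lower neighbour is absent, as in `T c 0`.
T*T-odd : ∀ b s c → OddPart b s c → OddPart (T* (T b)) s (T c)
T*T-odd b s c eq zero = begin
  T* (T b) 1
    ≡⟨ fold₁ (b 0) (b 1) (b 2) (b 3) ⟩
  + 2 ℤ.* b 1 ℤ.- b 3
    ≡⟨ cong₂ (λ u v → + 2 ℤ.* u ℤ.- v) (eq 0) (eq 1) ⟩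
  + 2 ℤ.* (s ℤ.* (1ℤ ℤ.* c 0)) ℤ.- s ℤ.* (-1ℤ ℤ.* 1ℤ ℤ.* c 1)
    ≡⟨ fold₂ s (c 0) (c 1) ⟩
  s ℤ.* (1ℤ ℤ.* T c 0) ∎
  where
  open ≡-Reasoning
  fold₁ : ∀ x y z w →
    + 2 ℤ.* (x ℤ.+ + 2 ℤ.* y ℤ.+ z) ℤ.- (+ 2 ℤ.* x ℤ.+ y) ℤ.- (y ℤ.+ + 2 ℤ.* z ℤ.+ w)
    ≡ + 2 ℤ.* y ℤ.- w
  fold₁ = ℤ.solve-∀
  fold₂ : ∀ s x y → + 2 ℤ.* (s ℤ.* (1ℤ ℤ.* x)) ℤ.- s ℤ.* (-1ℤ ℤ.* 1ℤ ℤ.* y)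
    ≡ s ℤ.* (1ℤ ℤ.* (+ 2 ℤ.* x ℤ.+ y))
  fold₂ = ℤ.solve-∀
T*T-odd b s c eq (suc l) = begin
  T* (T b) (2 + i)
    ≡⟨ fold₁ (b i) (b (1 + i)) (b (2 + i)) (b (3 + i)) (b (4 + i)) ⟩
  + 2 ℤ.* b (2 + i) ℤ.- b i ℤ.- b (4 + i)
    ≡⟨ cong₂ ℤ._-_ (cong₂ (λ u v → + 2 ℤ.* u ℤ.- v) (eq (suc l)) (eq l)) (eq (2 + l)) ⟩
  _ ≡⟨ fold₂ s (-1ℤ ℤ.^ l) (c l) (c (1 + l)) (c (2 + l)) ⟩
  s ℤ.* ((-1ℤ ℤ.^ suc l) ℤ.* T c (suc l)) ∎
  where
  open ≡-Reasoning
  i : ℕ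
  i = odd l
  fold₁ : ∀ v x y z w →
    + 2 ℤ.* (x ℤ.+ + 2 ℤ.* y ℤ.+ z) ℤ.- (v ℤ.+ + 2 ℤ.* x ℤ.+ y) ℤ.- (y ℤ.+ + 2 ℤ.* z ℤ.+ w)
    ≡ + 2 ℤ.* y ℤ.- v ℤ.- w
  fold₁ = ℤ.solve-∀
  fold₂ : ∀ s e x y z →
    + 2 ℤ.* (s ℤ.* (-1ℤ ℤ.* e ℤ.* y)) ℤ.- s ℤ.* (e ℤ.* x) ℤ.- s ℤ.* (-1ℤ ℤ.* (-1ℤ ℤ.* e) ℤ.* z)
    ≡ s ℤ.* (-1ℤ ℤ.* e ℤ.* (x ℤ.+ + 2 ℤ.* y ℤ.+ z))
  fold₂ = ℤ.solve-∀

-- Each step takes one `T` off the first row, moves it across as `T*`, and lets the resulting pair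
-- act on the base `b`, whose odd part advances from row `i` to row `i + 1`. Thus `i + m` is
-- invariant, and at `m = 0` the entry of the base at height 1 is read off. The cut-off `K` stays
-- fixed while `m` decreases, so that `m ≤ K` persists.
ω-row-fold : ∀ {K m} i b s → m ≤ K → OddPart b s (row i) →
  ω K (row m) (fold b T m) ≡ s ℤ.* row (i + m) 0
ω-row-fold {K} {zero} i b s _ eq = begin
  ω K (row 0) b                 ≡⟨ ω-row0 K b ⟩
  b 1                           ≡⟨ eq 0 ⟩
  s ℤ.* (1ℤ ℤ.* row i 0)        ≡⟨ cong (s ℤ.*_) (ℤ.*-identityˡ (row i 0)) ⟩
  s ℤ.* row i 0                 ≡⟨ cong (λ j → s ℤ.* row j 0) (+-identityʳ i) ⟨
  s ℤ.* row (i + 0) 0           ∎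
  where open ≡-Reasoning
ω-row-fold {K} {suc m} i b s m<K eq = begin
  ω K (row (suc m)) (T (fold b T m))    ≡⟨ ω-row-suc (T (fold b T m)) m<K ⟩
  ω K (row m) (T* (T (fold b T m)))     ≡⟨ ω-cong K {row m} {row m} (λ _ → refl) (T*T-fold b m) ⟩
  ω K (row m) (fold (T* (T b)) T m)
    ≡⟨ ω-row-fold {K} {m} (suc i) (T* (T b)) s (<⇒≤ m<K) eq′ ⟩
  s ℤ.* row (suc i + m) 0               ≡⟨ cong (λ j → s ℤ.* row j 0) (+-suc i m) ⟨
  s ℤ.* row (i + suc m) 0               ∎
  where
  open ≡-Reasoning
  eq′ : OddPart (T* (T b)) s (row (suc i))
  eq′ l = trans (T*T-odd b s (row i) eq l) (cong (λ t → s ℤ.* ((-1ℤ ℤ.^ l) ℤ.* t)) (sym (row-suc i l)))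

-- Row 1 is (2, 1, 0, ...), so its odd heights carry 1, 0, 0, ....
row1-odd : OddPart (row 1) 1ℤ (row 0)
row1-odd zero    = refl
row1-odd (suc l) = trans (cong +_ (motzkin-vanishes {1} {odd (suc l)} (s≤s (s≤s z≤n))))
  (identity (-1ℤ ℤ.^ suc l))
  where
  identity : ∀ s → 0ℤ ≡ 1ℤ ℤ.* (s ℤ.* 0ℤ)
  identity = ℤ.solve-∀

1≤odd : ∀ l → 1 ≤ odd l
1≤odd zero    = ≤-refl
1≤odd (suc l) = s≤s z≤n

-- Row 2 is (5, 4, 1, 0, ...), so its odd heights carry 4, 0, 0, ...; this entry 4 is the source of
-- the factor 4 for `j = 2`.
row2-odd : OddPart (row 2) (+ 4) (row 0)
row2-odd zero    = refl
row2-odd (suc l) = trans (cong +_ (motzkin-vanishes {2} {odd (suc l)} (s≤s (s≤s (1≤odd l)))))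
  (identity (-1ℤ ℤ.^ suc l))
  where
  identity : ∀ s → 0ℤ ≡ + 4 ℤ.* (s ℤ.* 0ℤ)
  identity = ℤ.solve-∀

ω-rows : ∀ n {j s} → OddPart (row j) s (row 0) → ω n (row n) (row (n + j)) ≡ s ℤ.* row n 0
ω-rows n {j} {s} eq = trans (ω-cong n {row n} {row n} (λ _ → refl) (row-+ n j))
  (ω-row-fold {n} {n} 0 (row j) s ≤-refl eq)

-- The closed form

binomial-factorial : ∀ a b → ((a + b) C a) * (a ! * b !) ≡ (a + b) !
binomial-factorial a b = begin
  ((a + b) C a) * (a ! * b !)            ≡⟨ *-comm ((a + b) C a) _ ⟩
  a ! * b ! * ((a + b) C a)              ≡⟨ cong (λ t → a ! * t ! * ((a + b) C a)) (m+n∸m≡n a b) ⟨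
  a ! * (a + b ∸ a) ! * ((a + b) C a)
    ≡⟨ cong (λ t → a ! * (a + b ∸ a) ! * t) (nCk≡n!/k![n-k]! (m≤m+n a b)) ⟩
  _                                      ≡⟨ m*[n/m]≡n (k![n∸k]!∣n! (m≤m+n a b)) ⟩
  (a + b) !                              ∎
  where
  open ≡-Reasoning
  instance
    nonZero : NonZero (a ! * (a + b ∸ a) !)
    nonZero = a !* (a + b ∸ a) !≢0

-- This is the formula (2k+2)/(2n+2) times the binomial coefficient of 2n+2 over n-k, with
-- denominators cleared: `m` is n - k, `q` is n + k + 2, and (2n+2)!/(2n+2) is (2n+1)!. Passing `m`
-- and `q` with equations avoids truncated subtraction and allows any provably equal forms of them.
ClosedRow : ℕ → Set
ClosedRow n = ∀ {k m q} → n ≡ m + k → q ≡ 2 + m + 2 * k →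
  motzkin n k * (m ! * q !) ≡ (2 * k + 2) * (1 + 2 * n) !

-- Unlike ClosedRow itself, these versions at heights k + 1 and k + 2 also cover
-- entries above the top of the row (m = 0, respectively m ≤ 1).
motzkin-closed₁ : ∀ {n k m q} → ClosedRow n → n ≡ m + k → q ≡ 2 + m + 2 * k →
  motzkin n (1 + k) * (m ! * (1 + q) !) ≡ (2 * k + 4) * m * (1 + 2 * n) !
motzkin-closed₁ {n} {k} {zero} {q} row-closed n≡ q≡ = begin
  motzkin n (1 + k) * (1 * (1 + q) !)
    ≡⟨ cong (_* (1 * (1 + q) !)) (motzkin-vanishes (s≤s (≤-reflexive n≡))) ⟩
  0
    ≡⟨ cong (_* (1 + 2 * n) !) (*-zeroʳ (2 * k + 4)) ⟨
  (2 * k + 4) * 0 * (1 + 2 * n) ! ∎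
  where open ≡-Reasoning
motzkin-closed₁ {n} {k} {suc m} {q} row-closed n≡ q≡ = begin
  motzkin n (1 + k) * (suc m ! * (1 + q) !)
    ≡⟨ regroup (motzkin n (1 + k)) m (m !) ((1 + q) !) ⟩
  suc m * (motzkin n (1 + k) * (m ! * (1 + q) !))
    ≡⟨ cong (suc m *_) (row-closed (trans n≡ (sym (+-suc m k))) (trans (cong suc q≡) (shift m k))) ⟩
  suc m * ((2 * (1 + k) + 2) * (1 + 2 * n) !)
    ≡⟨ regroup′ m k ((1 + 2 * n) !) ⟩
  (2 * k + 4) * suc m * (1 + 2 * n) ! ∎
  where
  open ≡-Reasoning
  shift : ∀ m k → 1 + (2 + suc m + 2 * k) ≡ 2 + m + 2 * (1 + k)
  shift = solve-∀
  regroup : ∀ a m f g → a * (suc m * f * g) ≡ suc m * (a * (f * g))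
  regroup = solve-∀
  regroup′ : ∀ m k f → suc m * ((2 * (1 + k) + 2) * f) ≡ (2 * k + 4) * suc m * f
  regroup′ = solve-∀

motzkin-closed₂ : ∀ {n k m q} → ClosedRow n → n ≡ m + k → q ≡ 2 + m + 2 * k →
  motzkin n (2 + k) * (m ! * (2 + q) !) ≡ (2 * k + 6) * (m * (m ∸ 1)) * (1 + 2 * n) !
motzkin-closed₂ {n} {k} {zero} {q} row-closed n≡ q≡ = begin
  motzkin n (2 + k) * (1 * (2 + q) !)
    ≡⟨ cong (_* (1 * (2 + q) !)) (motzkin-vanishes (s≤s (m≤n⇒m≤1+n (≤-reflexive n≡)))) ⟩
  0
    ≡⟨ cong (_* (1 + 2 * n) !) (*-zeroʳ (2 * k + 6)) ⟨
  (2 * k + 6) * 0 * (1 + 2 * n) ! ∎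
  where open ≡-Reasoning
motzkin-closed₂ {n} {k} {suc m} {q} row-closed n≡ q≡ = begin
  motzkin n (2 + k) * (suc m ! * (2 + q) !)
    ≡⟨ regroup (motzkin n (2 + k)) m (m !) ((2 + q) !) ⟩
  suc m * (motzkin n (2 + k) * (m ! * (2 + q) !))
    ≡⟨ cong (suc m *_) (motzkin-closed₁ row-closed (trans n≡ (sym (+-suc m k)))
                                                     (trans (cong suc q≡) (shift m k))) ⟩
  suc m * ((2 * (1 + k) + 4) * m * (1 + 2 * n) !)
    ≡⟨ regroup′ m k ((1 + 2 * n) !) ⟩
  (2 * k + 6) * (suc m * m) * (1 + 2 * n) ! ∎
  where
  open ≡-Reasoning
  shift : ∀ m k → 1 + (2 + suc m + 2 * k) ≡ 2 + m + 2 * (1 + k)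
  shift = solve-∀
  regroup : ∀ a m f g → a * (suc m * f * g) ≡ suc m * (a * (f * g))
  regroup = solve-∀
  regroup′ : ∀ m k f → suc m * ((2 * (1 + k) + 4) * m * f) ≡ (2 * k + 6) * (suc m * m) * f
  regroup′ = solve-∀

factorial-2step : ∀ n → (1 + 2 * suc n) ! ≡ (3 + 2 * n) * (2 + 2 * n) * (1 + 2 * n) !
factorial-2step n = trans (cong _! (shift n)) (sym (*-assoc (3 + 2 * n) (2 + 2 * n) ((1 + 2 * n) !)))
  where
  shift : ∀ n → 1 + 2 * suc n ≡ 3 + 2 * n
  shift = solve-∀

-- On the axis the recursion has only two terms. Over the common denominator (n+1)! (n+3)! the step
-- reduces to (n+1)(4(n+3) + 4n) = 2(2n+3)(2n+2).
motzkin-closed-axis : ∀ n → ClosedRow n →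
  motzkin (suc n) 0 * (suc n ! * (3 + n) !) ≡ 2 * (1 + 2 * suc n) !
motzkin-closed-axis n row-closed = begin
  (2 * A + B) * (suc n * n ! * ((3 + n) * (2 + n) !))
    ≡⟨ split A B n (n !) ((2 + n) !) ⟩
  suc n * (2 * (3 + n) * (A * (n ! * (2 + n) !)) + B * (n ! * (3 + n) !))
    ≡⟨ cong₂ (λ u v → suc n * (2 * (3 + n) * u + v))
         (row-closed n≡ q≡) (motzkin-closed₁ row-closed n≡ q≡) ⟩
  suc n * (2 * (3 + n) * (2 * F) + 4 * n * F)
    ≡⟨ merge n F ⟩
  2 * ((3 + 2 * n) * (2 + 2 * n) * F)
    ≡⟨ cong (2 *_) (factorial-2step n) ⟨
  2 * (1 + 2 * suc n) ! ∎
  where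
  open ≡-Reasoning
  A B F : ℕ
  A = motzkin n 0
  B = motzkin n 1
  F = (1 + 2 * n) !
  n≡ : n ≡ n + 0
  n≡ = sym (+-identityʳ n)
  q≡ : 2 + n ≡ 2 + n + 0
  q≡ = sym (+-identityʳ (2 + n))
  split : ∀ a b n f g → (2 * a + b) * (suc n * f * ((3 + n) * g)) ≡
    suc n * (2 * (3 + n) * (a * (f * g)) + b * (f * ((3 + n) * g)))
  split = solve-∀
  merge : ∀ n f → suc n * (2 * (3 + n) * (2 * f) + 4 * n * f) ≡ 2 * ((3 + 2 * n) * (2 + 2 * n) * f)
  merge = solve-∀

-- The three terms of the recursion are brought over `m ! * (2 + q) !`, the denominator belonging to
-- the new entry: raising both row and height by one keeps n - k and adds 2 to n + k + 2.
motzkin-closed-above : ∀ m k → ClosedRow (m + k) → let n = m + k; q = 2 + m + 2 * k in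
  motzkin (suc n) (suc k) * (m ! * (2 + q) !) ≡ (2 * k + 4) * (1 + 2 * suc n) !
motzkin-closed-above m k row-closed = begin
  (M₀ + 2 * M₁ + M₂) * (m ! * ((2 + q) * ((1 + q) * q !)))
    ≡⟨ split M₀ M₁ M₂ q (m !) (q !) ⟩
  (2 + q) * (1 + q) * (M₀ * (m ! * q !)) + 2 * (2 + q) * (M₁ * (m ! * (1 + q) !)) + M₂ * (m ! * (2 + q) !)
    ≡⟨ cong₂ _+_ (cong₂ (λ u v → (2 + q) * (1 + q) * u + 2 * (2 + q) * v)
                        (row-closed refl refl) (motzkin-closed₁ row-closed refl refl))
                 (motzkin-closed₂ row-closed refl refl) ⟩
  (2 + q) * (1 + q) * ((2 * k + 2) * F) + 2 * (2 + q) * ((2 * k + 4) * m * F)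
    + (2 * k + 6) * (m * (m ∸ 1)) * F
    ≡⟨ merge m ⟩
  (2 * k + 4) * ((3 + 2 * n) * (2 + 2 * n) * F)
    ≡⟨ cong ((2 * k + 4) *_) (factorial-2step n) ⟨
  (2 * k + 4) * (1 + 2 * suc n) ! ∎
  where
  open ≡-Reasoning
  n q M₀ M₁ M₂ F : ℕ
  n = m + k
  q = 2 + m + 2 * k
  M₀ = motzkin n k
  M₁ = motzkin n (1 + k)
  M₂ = motzkin n (2 + k)
  F = (1 + 2 * n) !
  split : ∀ a b c q f g → (a + 2 * b + c) * (f * ((2 + q) * ((1 + q) * g))) ≡
    (2 + q) * (1 + q) * (a * (f * g)) + 2 * (2 + q) * (b * (f * ((1 + q) * g)))
      + c * (f * ((2 + q) * ((1 + q) * g)))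
  split = solve-∀
  merge₀ : ∀ k f →
    (4 + 2 * k) * (3 + 2 * k) * ((2 * k + 2) * f) + 2 * (4 + 2 * k) * ((2 * k + 4) * 0 * f)
      + (2 * k + 6) * 0 * f ≡
    (2 * k + 4) * ((3 + 2 * k) * (2 + 2 * k) * f)
  merge₀ = solve-∀
  merge₁ : ∀ m k f →
    (5 + m + 2 * k) * (4 + m + 2 * k) * ((2 * k + 2) * f)
      + 2 * (5 + m + 2 * k) * ((2 * k + 4) * suc m * f) + (2 * k + 6) * (suc m * m) * f ≡
    (2 * k + 4) * ((3 + 2 * (suc m + k)) * (2 + 2 * (suc m + k)) * f)
  merge₁ = solve-∀
  merge : ∀ m → let n = m + k; q = 2 + m + 2 * k; F = (1 + 2 * n) ! in
    (2 + q) * (1 + q) * ((2 * k + 2) * F) + 2 * (2 + q) * ((2 * k + 4) * m * F)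
      + (2 * k + 6) * (m * (m ∸ 1)) * F ≡
    (2 * k + 4) * ((3 + 2 * n) * (2 + 2 * n) * F)
  -- The case split removes `m ∸ 1`, which is not a polynomial expression in `m`.
  merge zero    = merge₀ k ((1 + 2 * k) !)
  merge (suc m) = merge₁ m k ((1 + 2 * (suc m + k)) !)

motzkin-closed : ∀ n → ClosedRow n
motzkin-closed zero    {zero}  {zero} refl refl = refl
motzkin-closed (suc n) {zero}  {m}    n≡ refl
  with refl ← trans n≡ (+-identityʳ m) =
  trans (cong (λ t → motzkin (suc n) 0 * (suc n ! * t !)) (+-identityʳ (3 + n)))
        (motzkin-closed-axis n (motzkin-closed n))
motzkin-closed (suc n) {suc k} {m}    n≡ refl
  with refl ← suc-injective (trans n≡ (+-suc m k)) = begin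
  motzkin (suc n) (suc k) * (m ! * (2 + m + 2 * suc k) !)
    ≡⟨ cong (λ t → motzkin (suc n) (suc k) * (m ! * t !)) (shift m k) ⟩
  motzkin (suc n) (suc k) * (m ! * (4 + m + 2 * k) !)
    ≡⟨ motzkin-closed-above m k (motzkin-closed (m + k)) ⟩
  (2 * k + 4) * (1 + 2 * suc n) !
    ≡⟨ cong (_* (1 + 2 * suc n) !) (shift′ k) ⟩
  (2 * suc k + 2) * (1 + 2 * suc n) ! ∎
  where
  open ≡-Reasoning
  shift : ∀ m k → 2 + m + 2 * suc k ≡ 4 + m + 2 * k
  shift = solve-∀
  shift′ : ∀ k → 2 * k + 4 ≡ 2 * suc k + 2
  shift′ = solve-∀

motzkin-axis : ∀ n → motzkin n 0 ≡ Catalan (suc n)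
-- Multiplied by this factor, both sides become (2n+2)!: the extra `suc n` completes 2 (2n+1)! on
-- one side, and on the other it gives (n+2) (n+1)! (n+1)!.
motzkin-axis n = *-cancelʳ-≡ _ _ (n ! * (2 + n) ! * suc n) {{m*n≢0 _ _ {{n !* (2 + n) !≢0}}}} (begin
  motzkin n 0 * (n ! * (2 + n) ! * suc n)
    ≡⟨ *-assoc (motzkin n 0) _ (suc n) ⟨
  motzkin n 0 * (n ! * (2 + n) !) * suc n
    ≡⟨ cong (_* suc n) (motzkin-closed n (sym (+-identityʳ n)) (sym (+-identityʳ (2 + n)))) ⟩
  2 * (1 + 2 * n) ! * suc n
    ≡⟨ regroup n ((1 + 2 * n) !) ⟩
  (2 + 2 * n) !
    ≡⟨ cong _! (shift n) ⟩
  (suc n + suc n) !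
    ≡⟨ binomial-factorial (suc n) (suc n) ⟨
  ((suc n + suc n) C suc n) * (suc n ! * suc n !)
    ≡⟨ cong (λ t → ((suc n + t) C suc n) * (suc n ! * suc n !)) (+-identityʳ (suc n)) ⟨
  ((2 * suc n) C suc n) * (suc n ! * suc n !)
    ≡⟨ cong (_* (suc n ! * suc n !)) (Catalan-exact (suc n)) ⟨
  (2 + n) * Catalan (suc n) * (suc n ! * suc n !)
    ≡⟨ regroup′ n (Catalan (suc n)) (n !) ⟩
  Catalan (suc n) * (n ! * (2 + n) ! * suc n) ∎)
  where
  open ≡-Reasoning
  regroup : ∀ n f → 2 * f * suc n ≡ (2 + 2 * n) * f
  regroup = solve-∀
  shift : ∀ n → 2 + 2 * n ≡ suc n + suc n
  shift = solve-∀
  regroup′ : ∀ n c f → (2 + n) * c * (suc n * f * (suc n * f)) ≡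
    c * (f * ((2 + n) * (suc n * f)) * suc n)
  regroup′ = solve-∀

-- Minors in terms of binomial coefficients

-- A record rather than a bare equation, so that the numbers can be inferred.
record Scaled (i j A a F : ℕ) : Set where
  constructor scaled
  field equation : A * (i ! * j !) ≡ a * F

-- Together with `scaleʳ`, this brings entries and binomial coefficients with different factorials
-- over one common denominator.
scaleˡ : ∀ {i j A a F} → Scaled i j A a F → Scaled (suc i) j A (a * suc i) F
scaleˡ {i} {j} {A} {a} {F} (scaled eq) = scaled
  (trans (regroup A (suc i) (i !) (j !)) (trans (cong (_* suc i) eq) (swap a F (suc i))))
  where
  regroup : ∀ a s f g → a * (s * f * g) ≡ a * (f * g) * s
  regroup = solve-∀
  swap : ∀ a f s → a * f * s ≡ a * s * f
  swap = solve-∀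

scaleʳ : ∀ {i j A a F} → Scaled i j A a F → Scaled i (suc j) A (a * suc j) F
scaleʳ {i} {j} {A} {a} {F} (scaled eq) = scaled
  (trans (regroup A (suc j) (i !) (j !)) (trans (cong (_* suc j) eq) (swap a F (suc j))))
  where
  regroup : ∀ a s f g → a * (f * (s * g)) ≡ a * (f * g) * s
  regroup = solve-∀
  swap : ∀ a f s → a * f * s ≡ a * s * f
  swap = solve-∀

motzkin-scaled : ∀ n {k m q} → n ≡ m + k → q ≡ 2 + m + 2 * k →
  Scaled m q (motzkin n k) (2 * k + 2) ((1 + 2 * n) !)
motzkin-scaled n n≡ q≡ = scaled (motzkin-closed n n≡ q≡)

motzkin-scaled₁ : ∀ n {k m q} → n ≡ m + k → q ≡ 2 + m + 2 * k →
  Scaled m (1 + q) (motzkin n (1 + k)) ((2 * k + 4) * m) ((1 + 2 * n) !)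
motzkin-scaled₁ n n≡ q≡ = scaled (motzkin-closed₁ (motzkin-closed n) n≡ q≡)

binomial-scaled : ∀ {a b s} → s ≡ a + b → Scaled a b (s C a) 1 (s !)
binomial-scaled {a} {b} {s} refl = scaled (trans (binomial-factorial a b) (sym (*-identityˡ (s !))))

-- With everything over the common denominator `i ! * j !`, the factorials in the numerators match
-- by `F * F′ * Q ≡ R * S`, and the evaluation of the minor comes down to a polynomial identity
-- between the small numerators. That identity is stated additively, to stay in ℕ until the end.
minor-scaled : ∀ {i j A B A′ B′ X Y a b a′ b′ x y F F′ R S} c Q →
  Scaled i j A a F → Scaled i j B b F → Scaled i j A′ a′ F′ → Scaled i j B′ b′ F′ →
  Scaled i j X x R → Scaled i j Y y S →
  F * F′ * Q ≡ R * S → a * b′ ≡ c * (x * y) + b * a′ →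
  det₂ (+ A) (+ B) (+ A′) (+ B′) ℤ.* + Q ≡ + (c * (X * Y))
minor-scaled {i} {j} {A} {B} {A′} {B′} {X} {Y} {a} {b} {a′} {b′} {x} {y} {F} {F′} {R} {S} c Q
  (scaled Ad) (scaled Bd) (scaled A′d) (scaled B′d) (scaled Xd) (scaled Yd) FF′Q ab′ = begin
  (+ A ℤ.* + B′ ℤ.- + B ℤ.* + A′) ℤ.* + Q
    ≡⟨ expand (+ A) (+ B) (+ A′) (+ B′) (+ Q) ⟩
  + A ℤ.* + B′ ℤ.* + Q ℤ.- + B ℤ.* + A′ ℤ.* + Q
    ≡⟨ cong₂ ℤ._-_ (pos-*₃ A B′ Q) (pos-*₃ B A′ Q) ⟨
  + (A * B′ * Q) ℤ.- + (B * A′ * Q)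
    ≡⟨ cong (λ t → + t ℤ.- + (B * A′ * Q)) inℕ ⟩
  + (c * (X * Y)) ℤ.+ + (B * A′ * Q) ℤ.- + (B * A′ * Q)
    ≡⟨ cancel (+ (c * (X * Y))) (+ (B * A′ * Q)) ⟩
  + (c * (X * Y)) ∎
  where
  open ≡-Reasoning
  d : ℕ
  d = i ! * j !
  expand : ∀ a b c d q → (a ℤ.* d ℤ.- b ℤ.* c) ℤ.* q ≡ a ℤ.* d ℤ.* q ℤ.- b ℤ.* c ℤ.* q
  expand = ℤ.solve-∀
  cancel : ∀ a b → a ℤ.+ b ℤ.- b ≡ a
  cancel = ℤ.solve-∀
  pos-*₃ : ∀ i j k → + (i * j * k) ≡ + i ℤ.* + j ℤ.* + k
  pos-*₃ i j k = trans (ℤ.pos-* (i * j) k) (cong (ℤ._* + k) (ℤ.pos-* i j))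
  spread : ∀ i j q d → i * j * q * (d * d) ≡ i * d * (j * d) * q
  spread = solve-∀
  collect : ∀ i j f g q → i * f * (j * g) * q ≡ i * j * (f * g * q)
  collect = solve-∀
  gather : ∀ c x y t u v → (c * (x * y) + t) * (u * v) ≡ c * (x * u * (y * v)) + t * (u * v)
  gather = solve-∀
  unspread : ∀ c x y d r → c * (x * d * (y * d)) + r * (d * d) ≡ (c * (x * y) + r) * (d * d)
  unspread = solve-∀
  product : ∀ u v {u′ v′} → u * d ≡ u′ * F → v * d ≡ v′ * F′ → u * v * Q * (d * d) ≡ u′ * v′ * (R * S)
  product u v {u′} {v′} ud vd = begin
    u * v * Q * (d * d)       ≡⟨ spread u v Q d ⟩
    u * d * (v * d) * Q       ≡⟨ cong₂ (λ s t → s * t * Q) ud vd ⟩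
    u′ * F * (v′ * F′) * Q    ≡⟨ collect u′ v′ F F′ Q ⟩
    u′ * v′ * (F * F′ * Q)    ≡⟨ cong (u′ * v′ *_) FF′Q ⟩
    u′ * v′ * (R * S)         ∎
  inℕ : A * B′ * Q ≡ c * (X * Y) + B * A′ * Q
  -- Each product of two entries carries the denominator `d` twice.
  inℕ = *-cancelʳ-≡ _ _ (d * d) {{m*n≢0 d d {{i !* j !≢0}} {{i !* j !≢0}}}} (begin
    A * B′ * Q * (d * d)                              ≡⟨ product A B′ {a} {b′} Ad B′d ⟩
    a * b′ * (R * S)                                  ≡⟨ cong (_* (R * S)) ab′ ⟩
    (c * (x * y) + b * a′) * (R * S)                  ≡⟨ gather c x y (b * a′) R S ⟩
    c * (x * R * (y * S)) + b * a′ * (R * S)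
      ≡⟨ cong₂ (λ s t → c * s + t) (cong₂ _*_ Xd Yd) (product B A′ {b} {a′} Bd A′d) ⟨
    c * (X * d * (Y * d)) + B * A′ * Q * (d * d)      ≡⟨ unspread c X Y d (B * A′ * Q) ⟩
    (c * (X * Y) + B * A′ * Q) * (d * d)              ∎)

minor-binomial₁ : ∀ {n k} → k ≤ n →
  det₂ (row n k) (row n (suc k)) (row (1 + n) k) (row (1 + n) (suc k))
      ℤ.* + ((2 + 2 * n) * (3 + 2 * n) * (4 + 2 * n) ^ 2)
    ≡ + ((2 * k + 2) * (2 * k + 3) * (2 * k + 4)
         * (((2 * n + 4) C (n ∸ k)) * ((2 * n + 4) C (n ∸ k + 1))))
minor-binomial₁ {n} {k} k≤n = minor-scaled ((2 * k + 2) * (2 * k + 3) * (2 * k + 4)) _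
  (scaleˡ (scaleʳ (scaleʳ (motzkin-scaled n n≡ refl))))
  -- For `k = n` this entry lies above the top of row `n`, so the version that also covers `m = 0`
  -- is used. The common denominator is (m+1)! (q+2)!.
  (scaleˡ (scaleʳ (motzkin-scaled₁ n n≡ refl)))
  (scaleʳ (motzkin-scaled (1 + n) (cong suc n≡) refl))
  (scaleˡ (motzkin-scaled (1 + n) (trans (cong suc n≡) (sym (+-suc m k))) (shift m k)))
  (scaleˡ (binomial-scaled {m} {2 + q} 2n+4≡))
  (subst (λ t → Scaled (1 + m) (2 + q) ((2 * n + 4) C t) (1 * (2 + q)) R) (+-comm 1 m)
    (scaleʳ (binomial-scaled {1 + m} {1 + q} (trans 2n+4≡ (+-suc m (1 + q))))))
  FF′Q≡RR
  (polynomial m k)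
  where
  m q F F′ R : ℕ
  m = n ∸ k
  q = 2 + m + 2 * k
  F = (1 + 2 * n) !
  F′ = (1 + 2 * suc n) !
  R = (2 * n + 4) !
  n≡ : n ≡ m + k
  n≡ = sym (m∸n+n≡m k≤n)
  shift : ∀ m k → 4 + m + 2 * k ≡ 2 + m + 2 * suc k
  shift = solve-∀
  double : ∀ m k → 2 * (m + k) + 4 ≡ m + (4 + m + 2 * k)
  double = solve-∀
  2n+4≡ : 2 * n + 4 ≡ m + (2 + q)
  2n+4≡ = trans (cong (λ t → 2 * t + 4) n≡) (double m k)
  R≡ : R ≡ (4 + 2 * n) * F′
  R≡ = trans (cong _! (+-comm (2 * n) 4)) (cong (λ t → (4 + 2 * n) * t !) (shift′ n))
    where
    shift′ : ∀ n → 3 + 2 * n ≡ 1 + 2 * suc n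
    shift′ = solve-∀
  FF′Q≡RR : F * F′ * ((2 + 2 * n) * (3 + 2 * n) * (4 + 2 * n) ^ 2) ≡ R * R
  FF′Q≡RR = begin
    F * F′ * ((2 + 2 * n) * (3 + 2 * n) * (4 + 2 * n) ^ 2)
      ≡⟨ regroup F F′ (2 + 2 * n) (3 + 2 * n) (4 + 2 * n) ⟩
    (4 + 2 * n) * F′ * ((4 + 2 * n) * ((3 + 2 * n) * (2 + 2 * n) * F))
      ≡⟨ cong (λ t → (4 + 2 * n) * F′ * ((4 + 2 * n) * t)) (factorial-2step n) ⟨
    (4 + 2 * n) * F′ * ((4 + 2 * n) * F′)
      ≡⟨ cong₂ _*_ R≡ R≡ ⟨
    R * R ∎
    where
    open ≡-Reasoning
    regroup : ∀ f g x y z → f * g * (x * y * (z * (z * 1))) ≡ z * g * (z * (y * x * f))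
    regroup = solve-∀
  polynomial : ∀ m k → let q = 2 + m + 2 * k in
    (2 * k + 2) * (1 + q) * (2 + q) * (1 + m) * ((2 * suc k + 2) * (1 + m)) ≡
    (2 * k + 2) * (2 * k + 3) * (2 * k + 4) * (1 * (1 + m) * (1 * (2 + q)))
      + (2 * k + 4) * m * (2 + q) * (1 + m) * ((2 * k + 2) * (2 + q))
  polynomial = solve-∀

minor-binomial₂ : ∀ {n k} → k ≤ n →
  det₂ (row n k) (row n (suc k)) (row (2 + n) k) (row (2 + n) (suc k))
      ℤ.* + ((2 + 2 * n) * (3 + 2 * n) * (6 + 2 * n) * (7 + 2 * n))
    ≡ + (2 * ((2 * k + 2) * (2 * k + 3) * (2 * k + 4))
         * (((2 * n + 3) C (n ∸ k)) * ((2 * n + 7) C (n ∸ k + 2))))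
minor-binomial₂ {n} {k} k≤n = minor-scaled (2 * ((2 * k + 2) * (2 * k + 3) * (2 * k + 4))) _
  -- All six quantities are brought over (m+2)! (q+3)!, which the binomial coefficient of 2n+7 has
  -- from the start.
  (scaleˡ (scaleˡ (scaleʳ (scaleʳ (scaleʳ
    (motzkin-scaled n n≡ refl))))))
  (scaleˡ (scaleˡ (scaleʳ (scaleʳ
    (motzkin-scaled₁ n n≡ refl)))))
  (scaleʳ (motzkin-scaled (2 + n) (cong (λ t → 2 + t) n≡) refl))
  (scaleˡ (motzkin-scaled (2 + n)
    (trans (cong (λ t → 2 + t) n≡) (cong suc (sym (+-suc m k)))) (shift m k)))
  (scaleˡ (scaleˡ (scaleʳ (scaleʳ
    (binomial-scaled {m} {1 + q} 2n+3≡)))))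
  (subst (λ t → Scaled (2 + m) (3 + q) ((2 * n + 7) C t) 1 S) (+-comm 2 m)
    (binomial-scaled {2 + m} {3 + q} 2n+7≡))
  FF′Q≡RS
  (polynomial m k)
  where
  m q F F′ R S : ℕ
  m = n ∸ k
  q = 2 + m + 2 * k
  F = (1 + 2 * n) !
  F′ = (1 + 2 * (2 + n)) !
  R = (2 * n + 3) !
  S = (2 * n + 7) !
  n≡ : n ≡ m + k
  n≡ = sym (m∸n+n≡m k≤n)
  shift : ∀ m k → 5 + m + 2 * k ≡ 3 + m + 2 * suc k
  shift = solve-∀
  double₃ : ∀ m k → 2 * (m + k) + 3 ≡ m + (3 + m + 2 * k)
  double₃ = solve-∀
  double₇ : ∀ m k → 2 * (m + k) + 7 ≡ 2 + m + (5 + m + 2 * k)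
  double₇ = solve-∀
  2n+3≡ : 2 * n + 3 ≡ m + (1 + q)
  2n+3≡ = trans (cong (λ t → 2 * t + 3) n≡) (double₃ m k)
  2n+7≡ : 2 * n + 7 ≡ 2 + m + (3 + q)
  2n+7≡ = trans (cong (λ t → 2 * t + 7) n≡) (double₇ m k)
  R≡ : R ≡ (3 + 2 * n) * ((2 + 2 * n) * F)
  R≡ = cong _! (+-comm (2 * n) 3)
  S≡ : S ≡ (7 + 2 * n) * ((6 + 2 * n) * F′)
  S≡ = trans (cong _! (+-comm (2 * n) 7)) (cong (λ t → (7 + 2 * n) * ((6 + 2 * n) * t !)) (shift′ n))
    where
    shift′ : ∀ n → 5 + 2 * n ≡ 1 + 2 * (2 + n)
    shift′ = solve-∀
  FF′Q≡RS : F * F′ * ((2 + 2 * n) * (3 + 2 * n) * (6 + 2 * n) * (7 + 2 * n)) ≡ R * S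
  FF′Q≡RS = trans (regroup F F′ (2 + 2 * n) (3 + 2 * n) (6 + 2 * n) (7 + 2 * n))
    (sym (cong₂ _*_ R≡ S≡))
    where
    regroup : ∀ f g x y z w → f * g * (x * y * z * w) ≡ y * (x * f) * (w * (z * g))
    regroup = solve-∀
  polynomial : ∀ m k → let q = 2 + m + 2 * k in
    (2 * k + 2) * (1 + q) * (2 + q) * (3 + q) * (1 + m) * (2 + m) * ((2 * suc k + 2) * (2 + m)) ≡
    2 * ((2 * k + 2) * (2 * k + 3) * (2 * k + 4))
      * (1 * (2 + q) * (3 + q) * (1 + m) * (2 + m) * 1)
      + (2 * k + 4) * m * (2 + q) * (3 + q) * (1 + m) * (2 + m) * ((2 * k + 2) * (3 + q))
  polynomial = solve-∀

-- Rational sums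

-- Integers and the fractions of the theorem are images of explicit unnormalised fractions, so
-- products can be computed there without reducing to lowest terms.
fromℚᵘ-homo-* : ∀ p q → ℚ.fromℚᵘ p ℚ.* ℚ.fromℚᵘ q ≡ ℚ.fromℚᵘ (p ℚᵘ.* q)
fromℚᵘ-homo-* p q = ℚ.toℚᵘ-injective (begin-equality
  ℚ.toℚᵘ (ℚ.fromℚᵘ p ℚ.* ℚ.fromℚᵘ q)
    ≃⟨ ℚ.toℚᵘ-homo-* (ℚ.fromℚᵘ p) (ℚ.fromℚᵘ q) ⟩
  ℚ.toℚᵘ (ℚ.fromℚᵘ p) ℚᵘ.* ℚ.toℚᵘ (ℚ.fromℚᵘ q)
    ≃⟨ ℚᵘ.*-cong (ℚ.toℚᵘ-fromℚᵘ p) (ℚ.toℚᵘ-fromℚᵘ q) ⟩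
  p ℚᵘ.* q
    ≃⟨ ℚ.toℚᵘ-fromℚᵘ (p ℚᵘ.* q) ⟨
  ℚ.toℚᵘ (ℚ.fromℚᵘ (p ℚᵘ.* q)) ∎)
  where open ℚᵘ.≤-Reasoning

fromℚᵘ-homo-+ : ∀ p q → ℚ.fromℚᵘ p ℚ.+ ℚ.fromℚᵘ q ≡ ℚ.fromℚᵘ (p ℚᵘ.+ q)
fromℚᵘ-homo-+ p q = ℚ.toℚᵘ-injective (begin-equality
  ℚ.toℚᵘ (ℚ.fromℚᵘ p ℚ.+ ℚ.fromℚᵘ q)
    ≃⟨ ℚ.toℚᵘ-homo-+ (ℚ.fromℚᵘ p) (ℚ.fromℚᵘ q) ⟩
  ℚ.toℚᵘ (ℚ.fromℚᵘ p) ℚᵘ.+ ℚ.toℚᵘ (ℚ.fromℚᵘ q)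
    ≃⟨ ℚᵘ.+-cong (ℚ.toℚᵘ-fromℚᵘ p) (ℚ.toℚᵘ-fromℚᵘ q) ⟩
  p ℚᵘ.+ q
    ≃⟨ ℚ.toℚᵘ-fromℚᵘ (p ℚᵘ.+ q) ⟨
  ℚ.toℚᵘ (ℚ.fromℚᵘ (p ℚᵘ.+ q)) ∎)
  where open ℚᵘ.≤-Reasoning

fromℤ-homo-* : ∀ a b → fromℤ a ℚ.* fromℤ b ≡ fromℤ (a ℤ.* b)
fromℤ-homo-* a b = fromℚᵘ-homo-* (mkℚᵘ a 0) (mkℚᵘ b 0)

fromℤ-homo-+ : ∀ a b → fromℤ a ℚ.+ fromℤ b ≡ fromℤ (a ℤ.+ b)
fromℤ-homo-+ a b = trans (fromℚᵘ-homo-+ (mkℚᵘ a 0) (mkℚᵘ b 0))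
  (cong fromℤ (cong₂ ℤ._+_ (ℤ.*-identityʳ a) (ℤ.*-identityʳ b)))

fromℤ-∑ : ∀ n (f : ℕ → ℤ) → fromℤ (∑ℤ-syntax n f) ≡ ∑ℚ-syntax n (λ k → fromℤ (f k))
fromℤ-∑ zero    f = sym (fromℤ-homo-+ (f 0) 0ℤ)
fromℤ-∑ (suc n) f = trans (sym (fromℤ-homo-+ (f 0) (∑ℤ-syntax n (λ k → f (suc k)))))
  (cong (λ t → fromℤ (f 0) ℚ.+ t) (fromℤ-∑ n (λ k → f (suc k))))

-- The bound `k ≤ n` is passed on because the evaluation of the minors relies on `n ∸ k` being a
-- true difference.
∑ℚ-cong : ∀ n {f g : ℕ → ℚ} → (∀ {k} → k ≤ n → f k ≡ g k) → ∑ℚ-syntax n f ≡ ∑ℚ-syntax n g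
∑ℚ-cong n f≗g = Sumℚ.sum-cong-≗ {suc n} (λ i → f≗g (Fin.toℕ≤pred[n] i))

*-cancelˡ-pos : ∀ r .{{_ : ℚ.Positive r}} {p q} → r ℚ.* p ≡ r ℚ.* q → p ≡ q
*-cancelˡ-pos r eq = ℚ.≤-antisym (ℚ.*-cancelˡ-≤-pos r (ℚ.≤-reflexive eq))
                                 (ℚ.*-cancelˡ-≤-pos r (ℚ.≤-reflexive (sym eq)))

-- Between unnormalised fractions the equation is a cross multiplication, which is the hypothesis up
-- to regrouping. Matching on `suc Q-1` is needed since `mkℚᵘ` takes the denominator minus one.
fraction-term : ∀ {c z P X Y} Q .{{_ : NonZero Q}} →
  z ℤ.* + Q ≡ + (c * P * (X * Y)) →
  fromℕ c ℚ.* ((+ P ℚ./ Q) ℚ.* fromℕ X ℚ.* fromℕ Y) ≡ fromℤ z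
fraction-term {c} {z} {P} {X} {Y} Q@(suc Q-1) eq = begin
  fromℕ c ℚ.* (ℚ.fromℚᵘ p ℚ.* fromℕ X ℚ.* fromℕ Y)
    ≡⟨ cong (λ t → fromℕ c ℚ.* (t ℚ.* fromℕ Y)) (fromℚᵘ-homo-* p x) ⟩
  fromℕ c ℚ.* (ℚ.fromℚᵘ (p ℚᵘ.* x) ℚ.* fromℕ Y)
    ≡⟨ cong (fromℕ c ℚ.*_) (fromℚᵘ-homo-* (p ℚᵘ.* x) y) ⟩
  fromℕ c ℚ.* ℚ.fromℚᵘ (p ℚᵘ.* x ℚᵘ.* y)
    ≡⟨ fromℚᵘ-homo-* (mkℚᵘ (+ c) 0) (p ℚᵘ.* x ℚᵘ.* y) ⟩
  ℚ.fromℚᵘ (mkℚᵘ (+ c) 0 ℚᵘ.* (p ℚᵘ.* x ℚᵘ.* y))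
    ≡⟨ ℚ.fromℚᵘ-cong {mkℚᵘ (+ c) 0 ℚᵘ.* (p ℚᵘ.* x ℚᵘ.* y)} {mkℚᵘ z 0} (*≡* cross) ⟩
  fromℤ z ∎
  where
  open ≡-Reasoning
  p x y : ℚᵘ
  p = mkℚᵘ (+ P) Q-1
  x = mkℚᵘ (+ X) 0
  y = mkℚᵘ (+ Y) 0
  regroup : ∀ c p x y → c * p * (x * y) ≡ c * (p * x * y)
  regroup = solve-∀
  denominator : ∀ q → q ≡ 1 * (q * 1 * 1)
  denominator = solve-∀
  cross : + c ℤ.* (+ P ℤ.* + X ℤ.* + Y) ℤ.* 1ℤ ≡ z ℤ.* + (1 * (Q * 1 * 1))
  cross = begin
    + c ℤ.* (+ P ℤ.* + X ℤ.* + Y) ℤ.* 1ℤ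
      ≡⟨ ℤ.*-identityʳ _ ⟩
    + c ℤ.* (+ P ℤ.* + X ℤ.* + Y)
      ≡⟨ cong (λ t → + c ℤ.* (t ℤ.* + Y)) (ℤ.pos-* P X) ⟨
    + c ℤ.* (+ (P * X) ℤ.* + Y)
      ≡⟨ cong (λ t → + c ℤ.* t) (ℤ.pos-* (P * X) Y) ⟨
    + c ℤ.* + (P * X * Y)
      ≡⟨ ℤ.pos-* c (P * X * Y) ⟨
    + (c * (P * X * Y))
      ≡⟨ cong +_ (regroup c P X Y) ⟨
    + (c * P * (X * Y))
      ≡⟨ eq ⟨
    z ℤ.* + Q
      ≡⟨ cong (λ t → z ℤ.* + t) (denominator Q) ⟩
    z ℤ.* + (1 * (Q * 1 * 1)) ∎

-- The factor `c` is the ratio of a minor to the unsigned summand of the theorem. Both sides are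
-- compared after multiplication by `c`, which is then cancelled.
fraction-sum : ∀ n c {N} Q .{{_ : ℚ.Positive (fromℕ c)}} .{{_ : NonZero Q}}
  (z : ℕ → ℤ) (P X Y : ℕ → ℕ) →
  (∀ {k} → k ≤ n → z k ℤ.* + Q ≡ + (c * P k * (X k * Y k))) →
  ∑ℤ[ k ≤ n ] ((-1ℤ ℤ.^ k) ℤ.* z k) ≡ + (c * N) →
  fromℕ N ≡ ∑ℚ[ k ≤ n ] (fromℤ (-1ℤ ℤ.^ k) ℚ.* (+ P k ℚ./ Q) ℚ.* fromℕ (X k) ℚ.* fromℕ (Y k))
fraction-sum n c {N} Q z P X Y term total = *-cancelˡ-pos (fromℕ c) (begin
  fromℕ c ℚ.* fromℕ N
    ≡⟨ fromℤ-homo-* (+ c) (+ N) ⟩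
  fromℤ (+ c ℤ.* + N)
    ≡⟨ cong fromℤ (trans total (ℤ.pos-* c N)) ⟨
  fromℤ (∑ℤ[ k ≤ n ] ((-1ℤ ℤ.^ k) ℤ.* z k))
    ≡⟨ fromℤ-∑ n (λ k → (-1ℤ ℤ.^ k) ℤ.* z k) ⟩
  (∑ℚ[ k ≤ n ] fromℤ ((-1ℤ ℤ.^ k) ℤ.* z k))
    ≡⟨ ∑ℚ-cong n (λ {k} k≤n → sym (summand k k≤n)) ⟩
  (∑ℚ[ k ≤ n ] (fromℕ c ℚ.* (s k ℚ.* r k ℚ.* fromℕ (X k) ℚ.* fromℕ (Y k))))
    ≡⟨ Sumℚ.*-distribˡ-sum {suc n} (fromℕ c)
         (λ i → let k = toℕ i in s k ℚ.* r k ℚ.* fromℕ (X k) ℚ.* fromℕ (Y k)) ⟨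
  fromℕ c ℚ.* (∑ℚ[ k ≤ n ] (s k ℚ.* r k ℚ.* fromℕ (X k) ℚ.* fromℕ (Y k))) ∎)
  where
  open ≡-Reasoning
  s r : ℕ → ℚ
  s k = fromℤ (-1ℤ ℤ.^ k)
  r k = + P k ℚ./ Q
  regroup : ∀ c s r x y → c ℚ.* (s ℚ.* r ℚ.* x ℚ.* y) ≡ s ℚ.* (c ℚ.* (r ℚ.* x ℚ.* y))
  regroup c s r x y = begin
    c ℚ.* (s ℚ.* r ℚ.* x ℚ.* y)     ≡⟨ cong (λ t → c ℚ.* (t ℚ.* y)) (ℚ.*-assoc s r x) ⟩
    c ℚ.* (s ℚ.* (r ℚ.* x) ℚ.* y)   ≡⟨ cong (c ℚ.*_) (ℚ.*-assoc s (r ℚ.* x) y) ⟩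
    c ℚ.* (s ℚ.* (r ℚ.* x ℚ.* y))   ≡⟨ ℚ.*-assoc c s _ ⟨
    c ℚ.* s ℚ.* (r ℚ.* x ℚ.* y)     ≡⟨ cong (ℚ._* (r ℚ.* x ℚ.* y)) (ℚ.*-comm c s) ⟩
    s ℚ.* c ℚ.* (r ℚ.* x ℚ.* y)     ≡⟨ ℚ.*-assoc s c _ ⟩
    s ℚ.* (c ℚ.* (r ℚ.* x ℚ.* y))   ∎
  summand : ∀ k → k ≤ n →
    fromℕ c ℚ.* (s k ℚ.* r k ℚ.* fromℕ (X k) ℚ.* fromℕ (Y k)) ≡ fromℤ ((-1ℤ ℤ.^ k) ℤ.* z k)
  summand k k≤n = begin
    fromℕ c ℚ.* (s k ℚ.* r k ℚ.* fromℕ (X k) ℚ.* fromℕ (Y k))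
      ≡⟨ regroup (fromℕ c) (s k) (r k) (fromℕ (X k)) (fromℕ (Y k)) ⟩
    s k ℚ.* (fromℕ c ℚ.* (r k ℚ.* fromℕ (X k) ℚ.* fromℕ (Y k)))
      ≡⟨ cong (s k ℚ.*_) (fraction-term {c} {z k} {P k} {X k} {Y k} Q (term k≤n)) ⟩
    s k ℚ.* fromℤ (z k)
      ≡⟨ fromℤ-homo-* (-1ℤ ℤ.^ k) (z k) ⟩
    fromℤ ((-1ℤ ℤ.^ k) ℤ.* z k) ∎

-- Evaluation by Catalan numbers

catalan-ω : ∀ n j s → OddPart (row j) (+ s) (row 0) →
  ω n (row n) (row (j + n)) ≡ + (s * Catalan (n + 1))
catalan-ω n j s eq = begin
  ω n (row n) (row (j + n))
    -- The index `j + n` reduces for numeral `j`, as the binomial minors require; `ω-rows` has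
    -- `n + j`, that is, `n` applications of `T` to row `j`.
    ≡⟨ cong (λ i → ω n (row n) (row i)) (+-comm j n) ⟩
  ω n (row n) (row (n + j))
    ≡⟨ ω-rows n {j} {+ s} eq ⟩
  + s ℤ.* + motzkin n 0
    ≡⟨ ℤ.pos-* s (motzkin n 0) ⟨
  + (s * motzkin n 0)
    ≡⟨ cong (λ t → + (s * t)) (trans (motzkin-axis n) (cong Catalan (+-comm 1 n))) ⟩
  + (s * Catalan (n + 1)) ∎
  where open ≡-Reasoning

catalan-determinants : ∀ n j s → OddPart (row j) (+ s) (row 0) →
  ∑ℤ[ k ≤ n ] ((-1ℤ ℤ.^ k) ℤ.* det₂ (M n k (+ 2) (+ 2)) (M n (k + 1) (+ 2) (+ 2))
                                    (M (n + j) k (+ 2) (+ 2)) (M (n + j) (k + 1) (+ 2) (+ 2)))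
    ≡ + (s * Catalan (n + 1))
catalan-determinants n j s eq = trans (∑-cong n minor) (catalan-ω n j s eq)
  where
  entry : ∀ i k → M i (k + 1) (+ 2) (+ 2) ≡ row i (suc k)
  entry i k = trans (M≡motzkin i (k + 1)) (cong (row i) (+-comm k 1))
  minor : ∀ k → (-1ℤ ℤ.^ k) ℤ.* det₂ (M n k (+ 2) (+ 2)) (M n (k + 1) (+ 2) (+ 2))
                                   (M (n + j) k (+ 2) (+ 2)) (M (n + j) (k + 1) (+ 2) (+ 2))
              ≡ signedMinor (row n) (row (j + n)) k
  minor k rewrite +-comm j n | M≡motzkin n k | entry n k | M≡motzkin (n + j) k | entry (n + j) k = refl

theorem4p4 : ∀ (n : ℕ) →
    (∀ (j : ℕ) → j ≡ 1 ⊎ j ≡ 2 →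
    ∑ℤ[ k ≤ n ] ((-1ℤ ℤ.^ k) ℤ.* det₂ (M n k (+ 2) (+ 2)) (M n (k + 1) (+ 2) (+ 2))
    (M (n + j) k (+ 2) (+ 2)) (M (n + j) (k + 1) (+ 2) (+ 2)))
    ≡ + (4 ^ (j ∸ 1) * Catalan (n + 1)))
    ×
    (fromℕ (Catalan (n + 1)) ≡
    ∑ℚ[ k ≤ n ] (fromℤ (-1ℤ ℤ.^ k)
    ℚ.* (+ ((2 * k + 2) * (2 * k + 3) * (2 * k + 4)) ℚ./ ((2 + 2 * n) * (3 + 2 * n) * (4 + 2 * n) ^ 2))
    ℚ.* fromℕ ((2 * n + 4) C (n ∸ k))
    ℚ.* fromℕ ((2 * n + 4) C (n ∸ k + 1))))
    ×
    (fromℕ (2 * Catalan (n + 1)) ≡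
    ∑ℚ[ k ≤ n ] (fromℤ (-1ℤ ℤ.^ k)
    ℚ.* (+ ((2 * k + 2) * (2 * k + 3) * (2 * k + 4)) ℚ./ ((2 + 2 * n) * (3 + 2 * n) * (6 + 2 * n) * (7 + 2 * n)))
    ℚ.* fromℕ ((2 * n + 3) C (n ∸ k))
    ℚ.* fromℕ ((2 * n + 7) C (n ∸ k + 2))))
theorem4p4 n = determinants
  , fraction-sum n 1 {Catalan (n + 1)} ((2 + 2 * n) * (3 + 2 * n) * (4 + 2 * n) ^ 2)
      (minor 1) P (λ k → (2 * n + 4) C (n ∸ k)) (λ k → (2 * n + 4) C (n ∸ k + 1))
      (λ {k} k≤n → trans (minor-binomial₁ k≤n)
        (cong (λ p → + (p * (((2 * n + 4) C (n ∸ k)) * ((2 * n + 4) C (n ∸ k + 1)))))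
              (sym (*-identityˡ (P k)))))
      (catalan-ω n 1 1 row1-odd)
  , fraction-sum n 2 {2 * Catalan (n + 1)} ((2 + 2 * n) * (3 + 2 * n) * (6 + 2 * n) * (7 + 2 * n))
      (minor 2) P (λ k → (2 * n + 3) C (n ∸ k)) (λ k → (2 * n + 7) C (n ∸ k + 2))
      -- Each minor is twice its summand, so the total 4 C is split as 2 (2 C) and one factor 2 is
      -- cancelled.
      minor-binomial₂ (trans (catalan-ω n 2 4 row2-odd) (cong +_ (*-assoc 2 2 (Catalan (n + 1)))))
  where
  P : ℕ → ℕ
  P k = (2 * k + 2) * (2 * k + 3) * (2 * k + 4)
  minor : ℕ → ℕ → ℤ
  minor j k = det₂ (row n k) (row n (suc k)) (row (j + n) k) (row (j + n) (suc k))
  determinants : ∀ j → j ≡ 1 ⊎ j ≡ 2 → _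
  -- The factor `4 ^ (j ∸ 1)` computes to 1 and 4, the multiples found in rows 1 and 2.
  determinants j (inj₁ refl) = catalan-determinants n 1 1 row1-odd
  determinants j (inj₂ refl) = catalan-determinants n 2 4 row2-odd
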